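{- For every equational nominal unification problem $P$, if the pattern unification problem $[P]$ is solvable, then $P$ is solvable.
   Context: Nominal setting. Nominal terms $t::=f(t_1,\dots,t_n)\mid a\mid a.t\mid\pi\cdot X$ over atoms $a$ (of sorts of atoms), variables $X$, function symbols $f$, and permutations $\pi$ (finite sequences of swappings $(a\,b)$ of same-sort atoms, acting on atoms and homomorphically on terms, with $(a\,b)\cdot(c.t)=((a\,b)\cdot c).((a\,b)\cdot t)$, $\pi\cdot(\pi'\cdot X)=(\pi\pi')\cdot X$). Substitutions replace variables without renaming, with $\sigma(\pi\cdot X)=\pi\cdot\sigma(X)$. A freshness environment $\nabla$ is a finite set of constraints $a\#X$; $\nabla\vdash a\#t$ and $\nabla\vdash t\approx u$ are the least relations closed under: $\nabla\vdash a\#a'$ if $a\ne a'$; $\nabla\vdash a\#\pi\cdot X$ if $(\pi^{ -1}\cdot a)\#X\in\nabla$; $\nabla\vdash a\#f(\vec t)$ if all $\nabla\vdash a\#t_i$; $\nabla\vdash a\#a.t$; $\nabla\vdash a\#a'.t$ if $a\ne a'$, $\nabla\vdash a\#t$; $\nabla\vdash a\approx a$; $\nabla\vdash\pi\cdot X\approx\pi'\cdot X$ if $a\#X\in\nabla$ whenever $\pi\cdot a\ne\pi'\cdot a$; $\nabla\vdash f(\vec t)\approx f(\vec t')$ if all $\nabla\vdash t_i\approx t_i'$; $\nabla\vdash a.t\approx a.t'$ if $\nabla\vdash t\approx t'$; $\nabla\vdash a.t\approx a'.t'$ if $a\ne a'$, $\nabla\vdash t\approx(a\,a')\cdot t'$,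 $\nabla\vdash a\#t'$. An equational nominal unification problem $P$ is a finite set of equations $t\stackrel{?}{\approx}u$; it is solvable if some $\langle\nabla,\sigma\rangle$ satisfies $\nabla\vdash\sigma(t)\approx\sigma(u)$ for all equations. Translation: let $\langle a_1,\dots,a_n\rangle$ be an ordered list of the distinct atoms occurring in $P$. Base types named by sorts; $[\nu]=\nu$, $[\delta]=\delta$, $[\langle\nu\rangle\tau]=\nu\to[\tau]$, $[\tau_1\times\cdots\times\tau_n\to\tau]=[\tau_1]\to\cdots\to[\tau_n]\to[\tau]$; atoms become $\lambda$-variables of the same name, function symbols constants. $[a]_\emptyset=a$, $[f(t_1,\dots,t_n)]_\emptyset=f([t_1]_\emptyset,\dots)$, $[a.t]_\emptyset=\lambda a.[t]_\emptyset$, $[\pi\cdot X]_\emptyset=X([\pi\cdot a_1]_\emptyset,\dots,[\pi\cdot a_n]_\emptyset)$ with $X$ a free $\lambda$-variable of type $[\nu_1]\to\cdots\to[\nu_n]\to[\tau]$ ($a_i:\nu_i$, $X:\tau$). $[P]=\{\lambda a_1.\cdots\lambda a_n.[t]_\emptyset\stackrel{?}{=}\lambda a_1.\cdots\lambda a_n.[u]_\emptyset\mid t\stackrel{?}{\approx}u\in P\}$; it is solvable if some $\lambda$-substitution $\theta$ satisfies $\theta(s)=\theta(s')$ modulo $\alpha\beta\eta$ for all its equations.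
   Formalization: Function symbols are taken to have a result sort that is a data sort, as is standard in nominal signatures; with abstraction-sort results the claim fails (for f of sort ⟨ν⟩δ, the problem a.X ≈? f has a solvable translation by η but no nominal solution). -}

module Defs where

open import Data.Nat using (ℕ; zero; suc; _≡ᵇ_; _<ᵇ_; pred)
import Data.Nat.Properties as ℕP
open import Data.Bool using (Bool; true; false; if_then_else_)
open import Data.List using (List; []; _∷_; _++_; reverse; foldr; foldl)
open import Data.List.Membership.Propositional using (_∈_)
open import Data.List.Relation.Unary.All using (All)
open import Data.List.Relation.Unary.Unique.Propositional using (Unique)
open import Data.List.Relation.Binary.Pointwise using (Pointwise)
open import Data.Maybe using (Maybe; just; nothing)
open import Data.Product using (Σ; _×_; _,_; proj₁; proj₂; ∃₂)
open import Data.Product.Properties using (≡-dec)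
open import Relation.Nullary using (¬_; does)
open import Relation.Binary.Definitions using (DecidableEquality)
open import Relation.Binary.PropositionalEquality using (_≡_)
open import Function using (_⇔_)

data NSort (A D : Set) : Set where
  atmS : A → NSort A D
  datS : D → NSort A D
  absS : A → NSort A D → NSort A D

record Signature : Set₁ where
  field
    ASort  : Set
    _≟A_   : DecidableEquality ASort
    DSort  : Set
    Fun    : Set
    argSorts : Fun → List (NSort ASort DSort)
    resSort  : Fun → DSort

module _ (S : Signature) where
  open Signature S

  Sort : Set
  Sort = NSort ASort DSort

  Atom : Set
  Atom = ASort × ℕ

  sortOf : Atom → ASort
  sortOf = proj₁

  _≟_ : DecidableEquality Atom
  _≟_ = ≡-dec _≟A_ ℕP._≟_

  Var : Set
  Var = Sort × ℕ

  varSort : Var → Sort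
  varSort = proj₁

  Swap : Set
  Swap = Atom × Atom

  Perm : Set
  Perm = List Swap

  swapAtom : Swap → Atom → Atom
  swapAtom (a , b) c =
    if does (c ≟ a) then b else (if does (c ≟ b) then a else c)

  act : Perm → Atom → Atom
  act [] c = c
  act (s ∷ π) c = swapAtom s (act π c)

  inv : Perm → Perm
  inv = reverse

  OkPerm : Perm → Set
  OkPerm = All (λ s → sortOf (proj₁ s) ≡ sortOf (proj₂ s))

  data Term : Set where
    fun  : Fun → List Term → Term
    atom : Atom → Term
    abs  : Atom → Term → Term
    susp : Perm → Var → Term

  mutual
    _∙_ : Perm → Term → Term
    π ∙ fun f ts = fun f (π ∙s ts)
    π ∙ atom a = atom (act π a)
    π ∙ abs a t = abs (act π a) (π ∙ t)
    π ∙ susp π' X = susp (π ++ π') X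

    _∙s_ : Perm → List Term → List Term
    π ∙s [] = []
    π ∙s (t ∷ ts) = (π ∙ t) ∷ (π ∙s ts)

  NSubst : Set
  NSubst = Var → Term

  mutual
    nsub : NSubst → Term → Term
    nsub σ (fun f ts) = fun f (nsubs σ ts)
    nsub σ (atom a) = atom a
    nsub σ (abs a t) = abs a (nsub σ t)
    nsub σ (susp π X) = π ∙ σ X

    nsubs : NSubst → List Term → List Term
    nsubs σ [] = []
    nsubs σ (t ∷ ts) = nsub σ t ∷ nsubs σ ts

  data _∶ₛ_ : Term → Sort → Set where
    fun  : ∀ {f ts} → Pointwise _∶ₛ_ ts (argSorts f) → fun f ts ∶ₛ datS (resSort f)
    atom : ∀ a → atom a ∶ₛ atmS (sortOf a)
    abs  : ∀ {a t τ} → t ∶ₛ τ → abs a t ∶ₛ absS (sortOf a) τ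
    susp : ∀ {π X} → OkPerm π → susp π X ∶ₛ varSort X

  FreshEnv : Set
  FreshEnv = List (Atom × Var)

  data _⊢_#_ (∇ : FreshEnv) : Atom → Term → Set where
    #atom : ∀ {a a'} → ¬ a ≡ a' → ∇ ⊢ a # atom a'
    #susp : ∀ {a π X} → (act (inv π) a , X) ∈ ∇ → ∇ ⊢ a # susp π X
    #fun  : ∀ {a f ts} → All (∇ ⊢ a #_) ts → ∇ ⊢ a # fun f ts
    #abs= : ∀ {a t} → ∇ ⊢ a # abs a t
    #abs≠ : ∀ {a a' t} → ¬ a ≡ a' → ∇ ⊢ a # t → ∇ ⊢ a # abs a' t

  data _⊢_≈_ (∇ : FreshEnv) : Term → Term → Set where
    ≈atom : ∀ {a} → ∇ ⊢ atom a ≈ atom a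
    ≈susp : ∀ {π π' X} → (∀ a → ¬ act π a ≡ act π' a → (a , X) ∈ ∇) →
            ∇ ⊢ susp π X ≈ susp π' X
    ≈fun  : ∀ {f ts ts'} → Pointwise (∇ ⊢_≈_) ts ts' → ∇ ⊢ fun f ts ≈ fun f ts'
    ≈abs= : ∀ {a t t'} → ∇ ⊢ t ≈ t' → ∇ ⊢ abs a t ≈ abs a t'
    ≈abs≠ : ∀ {a a' t t'} → ¬ a ≡ a' → ∇ ⊢ t ≈ (((a , a') ∷ []) ∙ t') →
            ∇ ⊢ a # t' → ∇ ⊢ abs a t ≈ abs a' t'

  Problem : Set
  Problem = List (Term × Term)

  WellSorted : Problem → Set
  WellSorted = All (λ e → Σ Sort (λ τ → (proj₁ e ∶ₛ τ) × (proj₂ e ∶ₛ τ)))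

  NSolvable : Problem → Set
  NSolvable P = Σ FreshEnv λ ∇ → Σ NSubst λ σ →
    (∀ X → σ X ∶ₛ varSort X) ×
    All (λ e → ∇ ⊢ nsub σ (proj₁ e) ≈ nsub σ (proj₂ e)) P

  atomsPerm : Perm → List Atom
  atomsPerm [] = []
  atomsPerm ((a , b) ∷ π) = a ∷ b ∷ atomsPerm π

  mutual
    atomsT : Term → List Atom
    atomsT (fun f ts) = atomsTs ts
    atomsT (atom a) = a ∷ []
    atomsT (abs a t) = a ∷ atomsT t
    atomsT (susp π X) = atomsPerm π

    atomsTs : List Term → List Atom
    atomsTs [] = []
    atomsTs (t ∷ ts) = atomsT t ++ atomsTs ts

  atomsP : Problem → List Atom
  atomsP [] = []
  atomsP ((t , u) ∷ P) = atomsT t ++ atomsT u ++ atomsP P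

  AtomEnumeration : Problem → List Atom → Set
  AtomEnumeration P as = Unique as × (∀ a → (a ∈ as) ⇔ (a ∈ atomsP P))

  data Ty : Set where
    atomT : ASort → Ty
    dataT : DSort → Ty
    _⇒_   : Ty → Ty → Ty

  infixr 5 _⇒_

  ⟦_⟧ : Sort → Ty
  ⟦ atmS ν ⟧ = atomT ν
  ⟦ datS δ ⟧ = dataT δ
  ⟦ absS ν τ ⟧ = atomT ν ⇒ ⟦ τ ⟧

  sortsTy : List Sort → Ty → Ty
  sortsTy [] B = B
  sortsTy (τ ∷ τs) B = ⟦ τ ⟧ ⇒ sortsTy τs B

  funTy : Fun → Ty
  funTy f = sortsTy (argSorts f) (dataT (resSort f))

  data LTm (M : Set) : Set where
    var : ℕ → LTm M
    fv  : M → LTm M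
    con : Fun → LTm M
    lam : Ty → LTm M → LTm M
    _·_ : LTm M → LTm M → LTm M

  infixl 7 _·_

  data _∋_∶_ : List Ty → ℕ → Ty → Set where
    here  : ∀ {Γ A} → (A ∷ Γ) ∋ zero ∶ A
    there : ∀ {Γ A B i} → Γ ∋ i ∶ A → (B ∷ Γ) ∋ suc i ∶ A

  data Typed {M : Set} (tyM : M → Ty) (Γ : List Ty) : LTm M → Ty → Set where
    var : ∀ {i A} → Γ ∋ i ∶ A → Typed tyM Γ (var i) A
    fv  : ∀ X → Typed tyM Γ (fv X) (tyM X)
    con : ∀ f → Typed tyM Γ (con f) (funTy f)
    lam : ∀ {A B t} → Typed tyM (A ∷ Γ) t B → Typed tyM Γ (lam A t) (A ⇒ B)
    app : ∀ {A B s u} → Typed tyM Γ s (A ⇒ B) → Typed tyM Γ u A →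
          Typed tyM Γ (s · u) B

  shift : ∀ {M} → ℕ → LTm M → LTm M
  shift c (var i) = if i <ᵇ c then var i else var (suc i)
  shift c (fv X) = fv X
  shift c (con f) = con f
  shift c (lam A t) = lam A (shift (suc c) t)
  shift c (s · u) = shift c s · shift c u

  bsub : ∀ {M} → ℕ → LTm M → LTm M → LTm M
  bsub j u (var i) =
    if i ≡ᵇ j then u else (if i <ᵇ j then var i else var (pred i))
  bsub j u (fv X) = fv X
  bsub j u (con f) = con f
  bsub j u (lam A t) = lam A (bsub (suc j) (shift zero u) t)
  bsub j u (s · t) = bsub j u s · bsub j u t

  -- βη-convertibility (α is built into de Bruijn syntax)
  data _≃βη_ {M : Set} : LTm M → LTm M → Set where
    β     : ∀ {A s u} → (lam A s · u) ≃βη bsub zero u s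
    η     : ∀ {A s} → lam A (shift zero s · var zero) ≃βη s
    refl  : ∀ {s} → s ≃βη s
    sym   : ∀ {s s'} → s ≃βη s' → s' ≃βη s
    trans : ∀ {s s' s''} → s ≃βη s' → s' ≃βη s'' → s ≃βη s''
    lamc  : ∀ {A s s'} → s ≃βη s' → lam A s ≃βη lam A s'
    appc  : ∀ {s s' u u'} → s ≃βη s' → u ≃βη u' → (s · u) ≃βη (s' · u')

  lsub : ∀ {M M'} → (M → LTm M') → LTm M → LTm M'
  lsub θ (var i) = var i
  lsub θ (fv X) = θ X
  lsub θ (con f) = con f
  lsub θ (lam A t) = lam A (lsub θ t)
  lsub θ (s · u) = lsub θ s · lsub θ u

  index : Atom → List Atom → Maybe ℕ
  index a [] = nothing
  index a (b ∷ ctx) with does (a ≟ b)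
  ... | true = just zero
  ... | false with index a ctx
  ...   | just i = just (suc i)
  ...   | nothing = nothing

  suspArgs : List Atom → Perm → List Atom → LTm Var → Maybe (LTm Var)
  suspArgs ctx π [] h = just h
  suspArgs ctx π (a ∷ as) h with index (act π a) ctx
  ... | just i = suspArgs ctx π as (h · var i)
  ... | nothing = nothing

  mutual
    -- [t] under binder context ctx (innermost first)
    tr : List Atom → List Atom → Term → Maybe (LTm Var)
    tr as ctx (fun f ts) = trs as ctx ts (con f)
    tr as ctx (atom a) with index a ctx
    ... | just i = just (var i)
    ... | nothing = nothing
    tr as ctx (abs a t) with tr as (a ∷ ctx) t
    ... | just s = just (lam (atomT (sortOf a)) s)
    ... | nothing = nothing
    tr as ctx (susp π X) = suspArgs ctx π as (fv X)

    trs : List Atom → List Atom → List Term → LTm Var → Maybe (LTm Var)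
    trs as ctx [] h = just h
    trs as ctx (t ∷ ts) h with tr as ctx t
    ... | just s = trs as ctx ts (h · s)
    ... | nothing = nothing

  lams : List Atom → LTm Var → LTm Var
  lams [] s = s
  lams (a ∷ as) s = lam (atomT (sortOf a)) (lams as s)

  trTop : List Atom → Term → Maybe (LTm Var)
  trTop as t with tr as (reverse as) t
  ... | just s = just (lams as s)
  ... | nothing = nothing

  tyVar : List Atom → Var → Ty
  tyVar [] X = ⟦ varSort X ⟧
  tyVar (a ∷ as) X = atomT (sortOf a) ⇒ tyVar as X

  -- [P] is solvable: some well-typed λ-substitution θ (whose range may use
  -- any set M of typed free variables) unifies every translated equation
  -- modulo αβη.
  LSolvable : List Atom → Problem → Set₁
  LSolvable as P =
    Σ Set λ M → Σ (M → Ty) λ tyM → Σ (Var → LTm M) λ θ →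
      (∀ X → Typed tyM [] (θ X) (tyVar as X)) ×
      All (λ e → ∃₂ λ s s' →
             (trTop as (proj₁ e) ≡ just s) × (trTop as (proj₂ e) ≡ just s') ×
             (lsub θ s ≃βη lsub θ s')) P

{-# OPTIONS --safe #-}
module Submission where

-- Instantiate the metavariables in the range of a λ-unifier θ by constant functions
-- whose values are fresh atoms, or nominal variables for which every relevant atom
-- is fresh. By a reducibility argument, θ X a₁ … aₙ then has an η-long normal form
-- that is the code of a nominal term; call it σ X. The code of σ t is βη-convertible
-- to the translation of t under θ, so σ t and σ u have convertible codes whenever
-- t ≈? u is an equation of P. Convertible η-long forms coincide, and terms with equal
-- codes are α-equivalent under the freshness environment just described.
-- Intermediate terms of a conversion may be ill-typed, hence the appeal to
-- confluence of the untyped βη-calculus.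

open import Defs hiding (sym; trans)
open import Data.Bool using (if_then_else_; true; false)
open import Data.List using (List; []; _∷_; _++_; foldl; map; reverse; cartesianProduct)
open import Data.List.Extrema.Nat using (max; xs≤max)
open import Data.List.Membership.Propositional using (_∈_)
open import Data.List.Membership.Propositional.Properties using (∈-map⁺; ∈-++⁺ˡ; ∈-++⁺ʳ; ∈-cartesianProduct⁺)
open import Data.List.Properties using (++-identityʳ; map-∘; ∷-injectiveˡ; ∷-injectiveʳ)
open import Data.List.Relation.Binary.Pointwise using (Pointwise; []; _∷_)
open import Data.List.Relation.Binary.Subset.Propositional using (_⊆_)
open import Data.List.Relation.Unary.All as All using (All; []; _∷_)
import Data.List.Relation.Unary.All.Properties as AllP
open import Data.List.Relation.Unary.Any as Any using (here; there)
import Data.List.Relation.Unary.Any.Properties as AnyP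
open import Data.Maybe as Maybe using (Maybe; just; nothing; maybe′)
open import Data.Maybe.Properties using (just-injective)
open import Data.Nat using (ℕ; zero; suc; pred; _≡ᵇ_; _<ᵇ_; _+_; _⊔_; _≤_; _<_; s≤s)
open import Data.Nat.Properties using (≤-refl; ≤-trans; ≤-reflexive; m≤m+n; m≤n+m; +-monoˡ-≤; n≤1+n; m≤m⊔n; m≤n⊔m; <-irrefl)
open import Data.Product using (∃; ∃₂; _×_; _,_; proj₁; proj₂; map₂; swap)
open import Data.Sum using (_⊎_; inj₁; inj₂)
open import Data.Unit using (⊤; tt)
open import Function using (_∘_; id; case_of_; Equivalence)
open import Relation.Binary.Construct.Closure.ReflexiveTransitive using (Star; ε; _◅_; _◅◅_; gmap)
open import Relation.Binary.PropositionalEquality using (_≡_; refl; sym; trans; cong; cong₂; subst)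
open import Relation.Binary.Rewriting using (Confluent)
open import Relation.Nullary using (¬_; yes; no; does; contradiction)
open import Relation.Nullary.Decidable using (dec-true; dec-false)

-- Untyped λ-terms: renaming and substitution.

private
  variable
    U V W : Set

-- Free variables are drawn from an arbitrary set, and a binder adds one element through `Maybe`.
-- Atoms can thus be free variables, and permutations act on them by renaming.
data Λ (V : Set) : Set where
  var : V → Λ V
  lam : Λ (Maybe V) → Λ V
  app : Λ V → Λ V → Λ V

Occ : V → Λ V → Set
Occ x (var y) = x ≡ y
Occ x (lam t) = Occ (just x) t
Occ x (app s t) = Occ x s ⊎ Occ x t

ren : (V → W) → Λ V → Λ W
ren f (var x) = var (f x)
ren f (lam t) = lam (ren (Maybe.map f) t)
ren f (app s t) = app (ren f s) (ren f t)

wk : Λ V → Λ (Maybe V)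
wk = ren just

lift : (V → Λ W) → Maybe V → Λ (Maybe W)
lift s = maybe′ (wk ∘ s) (var nothing)

sub : (V → Λ W) → Λ V → Λ W
sub s (var x) = s x
sub s (lam t) = lam (sub (lift s) t)
sub s (app t u) = app (sub s t) (sub s u)

inst : Λ V → Maybe V → Λ V
inst u = maybe′ var u

_[_] : Λ (Maybe V) → Λ V → Λ V
t [ u ] = sub (inst u) t

-- Agreement on occurring variables is what freshness provides: abstracting an atom acts as a
-- weakening only on terms that avoid the atom.
ren-cong-Occ : {f g : V → W} (t : Λ V) → (∀ x → Occ x t → f x ≡ g x) → ren f t ≡ ren g t
ren-cong-Occ (var x) f≗g = cong var (f≗g x refl)
ren-cong-Occ (lam t) f≗g = cong lam (ren-cong-Occ t λ where
  nothing _ → refl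
  (just x) o → cong just (f≗g x o))
ren-cong-Occ (app s t) f≗g =
  cong₂ app (ren-cong-Occ s λ x o → f≗g x (inj₁ o)) (ren-cong-Occ t λ x o → f≗g x (inj₂ o))

ren-cong : {f g : V → W} → (∀ x → f x ≡ g x) → (t : Λ V) → ren f t ≡ ren g t
ren-cong f≗g t = ren-cong-Occ t λ x _ → f≗g x

ren-ren : {f : U → V} {g : V → W} (t : Λ U) → ren g (ren f t) ≡ ren (g ∘ f) t
ren-ren (var x) = refl
ren-ren (lam t) = cong lam (trans (ren-ren t) (ren-cong (λ { nothing → refl ; (just _) → refl }) t))
ren-ren (app s t) = cong₂ app (ren-ren s) (ren-ren t)

Occ-ren : (f : V → W) {x : V} (t : Λ V) → Occ x t → Occ (f x) (ren f t)
Occ-ren f (var y) o = cong f o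
Occ-ren f (lam t) o = Occ-ren (Maybe.map f) t o
Occ-ren f (app s t) (inj₁ o) = inj₁ (Occ-ren f s o)
Occ-ren f (app s t) (inj₂ o) = inj₂ (Occ-ren f t o)

Occ-ren⁻¹ : (f : V → W) {y : W} (t : Λ V) → Occ y (ren f t) → ∃ λ x → Occ x t × y ≡ f x
Occ-ren⁻¹ f (var x) o = x , refl , o
Occ-ren⁻¹ f (lam t) o with Occ-ren⁻¹ (Maybe.map f) t o
... | just x , o′ , refl = x , o′ , refl
Occ-ren⁻¹ f (app s t) (inj₁ o) with Occ-ren⁻¹ f s o
... | x , o′ , e = x , inj₁ o′ , e
Occ-ren⁻¹ f (app s t) (inj₂ o) with Occ-ren⁻¹ f t o
... | x , o′ , e = x , inj₂ o′ , e

sub-cong : {s s′ : V → Λ W} → (∀ x → s x ≡ s′ x) → (t : Λ V) → sub s t ≡ sub s′ t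
sub-cong e (var x) = e x
sub-cong e (lam t) = cong lam (sub-cong (λ { nothing → refl ; (just x) → cong wk (e x) }) t)
sub-cong e (app t u) = cong₂ app (sub-cong e t) (sub-cong e u)

sub-var : (t : Λ V) → sub var t ≡ t
sub-var (var x) = refl
sub-var (lam t) = cong lam (trans (sub-cong (λ { nothing → refl ; (just _) → refl }) t) (sub-var t))
sub-var (app s t) = cong₂ app (sub-var s) (sub-var t)

ren-as-sub : {f : V → W} (t : Λ V) → ren f t ≡ sub (var ∘ f) t
ren-as-sub (var x) = refl
ren-as-sub (lam t) = cong lam (trans (ren-as-sub t) (sub-cong (λ { nothing → refl ; (just _) → refl }) t))
ren-as-sub (app s t) = cong₂ app (ren-as-sub s) (ren-as-sub t)

ren-id : {f : V → V} → (∀ x → f x ≡ x) → (t : Λ V) → ren f t ≡ t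
ren-id e t = trans (ren-as-sub t) (trans (sub-cong (cong var ∘ e) t) (sub-var t))

sub-ren : {f : U → V} {s : V → Λ W} (t : Λ U) → sub s (ren f t) ≡ sub (s ∘ f) t
sub-ren (var x) = refl
sub-ren (lam t) = cong lam (trans (sub-ren t) (sub-cong (λ { nothing → refl ; (just _) → refl }) t))
sub-ren (app s t) = cong₂ app (sub-ren s) (sub-ren t)

map-wk : {f : V → W} (t : Λ V) → ren (Maybe.map f) (wk t) ≡ wk (ren f t)
map-wk t = trans (ren-ren t) (sym (ren-ren t))

ren-sub : {s : U → Λ V} {f : V → W} (t : Λ U) → ren f (sub s t) ≡ sub (ren f ∘ s) t
ren-sub (var x) = refl
ren-sub {s = s} (lam t) =
  cong lam (trans (ren-sub t) (sub-cong (λ { nothing → refl ; (just x) → map-wk (s x) }) t))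
ren-sub (app s t) = cong₂ app (ren-sub s) (ren-sub t)

lift-wk : {s : V → Λ W} (t : Λ V) → sub (lift s) (wk t) ≡ wk (sub s t)
lift-wk t = trans (sub-ren t) (sym (ren-sub t))

sub-sub : {s : U → Λ V} {r : V → Λ W} (t : Λ U) → sub r (sub s t) ≡ sub (sub r ∘ s) t
sub-sub (var x) = refl
sub-sub {s = s} (lam t) =
  cong lam (trans (sub-sub t) (sub-cong (λ { nothing → refl ; (just x) → lift-wk (s x) }) t))
sub-sub (app s t) = cong₂ app (sub-sub s) (sub-sub t)

wk-inst : {u : Λ V} (t : Λ V) → wk t [ u ] ≡ t
wk-inst t = trans (sub-ren t) (sub-var t)

sub-inst : {s : V → Λ W} (t : Λ (Maybe V)) (u : Λ V) → sub s (t [ u ]) ≡ sub (lift s) t [ sub s u ]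
sub-inst {s = s} t u = trans (sub-sub t) (sym (trans (sub-sub t)
  (sub-cong (λ { nothing → refl ; (just x) → wk-inst (s x) }) t)))

ren-inst : {f : V → W} (t : Λ (Maybe V)) (u : Λ V) → ren f (t [ u ]) ≡ ren (Maybe.map f) t [ ren f u ]
ren-inst t u = trans (ren-sub t) (sym (trans (sub-ren t)
  (sub-cong (λ { nothing → refl ; (just x) → refl }) t)))

-- This is the β-step inside the η-expansion of an abstraction: it gives back the body.
map-just-inst : (t : Λ (Maybe V)) → ren (Maybe.map just) t [ var nothing ] ≡ t
map-just-inst t = trans (sub-ren t) (trans (sub-cong (λ { nothing → refl ; (just _) → refl }) t) (sub-var t))

var-injective : {x y : V} → Λ.var x ≡ var y → x ≡ y
var-injective refl = refl

app-injective : {s s′ t t′ : Λ V} → app s t ≡ app s′ t′ → s ≡ s′ × t ≡ t′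
app-injective refl = refl , refl

lam-injective : {s t : Λ (Maybe V)} → lam s ≡ lam t → s ≡ t
lam-injective refl = refl

wk-injective : {s t : Λ V} → wk s ≡ wk t → s ≡ t
wk-injective {s = s} {t} e =
  trans (sym (wk-inst {u = s} s)) (trans (cong _[ s ] e) (wk-inst t))

-- Renaming preserves weak pullback squares of functions.
ren-pullback : {A : Set} {f : U → W} {g : V → W} {h : A → U} {k : A → V} →
  (∀ x y → f x ≡ g y → ∃ λ z → x ≡ h z × y ≡ k z) →
  (s : Λ U) (t : Λ V) → ren f s ≡ ren g t → ∃ λ r → s ≡ ren h r × t ≡ ren k r
ren-pullback pb (var x) (var y) e with pb x y (var-injective e)
... | z , refl , refl = var z , refl , refl
ren-pullback {f = f} {g} {h} {k} pb (lam s) (lam t) e with ren-pullback pb′ s t (lam-injective e)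
  where
  pb′ : ∀ x y → Maybe.map f x ≡ Maybe.map g y → ∃ λ z → x ≡ Maybe.map h z × y ≡ Maybe.map k z
  pb′ nothing nothing _ = nothing , refl , refl
  pb′ (just x) (just y) e with pb x y (just-injective e)
  ... | z , refl , refl = just z , refl , refl
... | r , refl , refl = lam r , refl , refl
ren-pullback pb (app s s′) (app t t′) e
  with ren-pullback pb s t (proj₁ (app-injective e)) | ren-pullback pb s′ t′ (proj₂ (app-injective e))
... | r , refl , refl | r′ , refl , refl = app r r′ , refl , refl

-- Confluence of βη-reduction

infix 4 _⇛_

-- Parallel βη-reduction. β-contracta and η-redexes enter through equations, since `sub` or `ren` in
-- an index would obstruct case analysis.
data _⇛_ {V : Set} : Λ V → Λ V → Set where
  var : ∀ x → var x ⇛ var x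
  lam : ∀ {s s′} → s ⇛ s′ → lam s ⇛ lam s′
  app : ∀ {s s′ t t′} → s ⇛ s′ → t ⇛ t′ → app s t ⇛ app s′ t′
  β   : ∀ {s s′ t t′ p} → s ⇛ s′ → t ⇛ t′ → p ≡ s′ [ t′ ] → app (lam s) t ⇛ p
  η   : ∀ {s r p} → s ≡ app (wk r) (var nothing) → r ⇛ p → lam s ⇛ p

⇛-refl : (t : Λ V) → t ⇛ t
⇛-refl (var x) = var x
⇛-refl (lam t) = lam (⇛-refl t)
⇛-refl (app s t) = app (⇛-refl s) (⇛-refl t)

⇛-ren : (f : V → W) {s t : Λ V} → s ⇛ t → ren f s ⇛ ren f t
⇛-ren f (var x) = var (f x)
⇛-ren f (lam p) = lam (⇛-ren (Maybe.map f) p)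
⇛-ren f (app p q) = app (⇛-ren f p) (⇛-ren f q)
⇛-ren f (β {s′ = s′} {t′ = t′} p q refl) =
  β (⇛-ren (Maybe.map f) p) (⇛-ren f q) (ren-inst s′ t′)
⇛-ren f (η {r = r} refl p) = η (cong (λ z → app z (var nothing)) (map-wk r)) (⇛-ren f p)

⇛-lift : {s s′ : V → Λ W} → (∀ x → s x ⇛ s′ x) → ∀ x → lift s x ⇛ lift s′ x
⇛-lift e nothing = var nothing
⇛-lift e (just x) = ⇛-ren just (e x)

⇛-sub : {s s′ : V → Λ W} {t t′ : Λ V} → (∀ x → s x ⇛ s′ x) → t ⇛ t′ → sub s t ⇛ sub s′ t′
⇛-sub e (var x) = e x
⇛-sub e (lam p) = lam (⇛-sub (⇛-lift e) p)
⇛-sub e (app p q) = app (⇛-sub e p) (⇛-sub e q)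
⇛-sub e (β {s′ = s′} {t′ = t′} p q refl) = β (⇛-sub (⇛-lift e) p) (⇛-sub e q) (sub-inst s′ t′)
⇛-sub e (η {r = r} refl p) = η (cong (λ z → app z (var nothing)) (lift-wk r)) (⇛-sub e p)

⇛-inst : {t t′ : Λ (Maybe V)} {u u′ : Λ V} → t ⇛ t′ → u ⇛ u′ → t [ u ] ⇛ t′ [ u′ ]
⇛-inst p q = ⇛-sub (λ { nothing → q ; (just x) → var x }) p

-- Reduction creates no free variables. In particular a reduct of `wk r` is again weakened, so an
-- η-redex survives steps inside its function part.
⇛-ren⁻¹ : (f : V → W) (t : Λ V) {u p : Λ W} → u ⇛ p → u ≡ ren f t → ∃ λ t′ → p ≡ ren f t′ × t ⇛ t′
⇛-ren⁻¹ f (var x) (var _) refl = var x , refl , var x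
⇛-ren⁻¹ f (lam t) (lam p) refl with ⇛-ren⁻¹ (Maybe.map f) t p refl
... | t′ , refl , p′ = lam t′ , refl , lam p′
⇛-ren⁻¹ f (lam (app s (var nothing))) (η {r = r} e p) refl
  -- The function part of the redex is both a weakening and a renaming along `Maybe.map f`. The
  -- square formed by `just` and `f` is a pullback, so that part comes from a term over `V`.
  with ren-pullback {h = just} {k = f} (λ { (just x) y refl → x , refl , refl }) s r (proj₁ (app-injective e))
... | r′ , refl , refl with ⇛-ren⁻¹ f r′ p refl
...   | t′ , refl , p′ = t′ , refl , η refl p′
⇛-ren⁻¹ f (app s t) (app p q) refl with ⇛-ren⁻¹ f s p refl | ⇛-ren⁻¹ f t q refl
... | s′ , refl , p′ | t′ , refl , q′ = app s′ t′ , refl , app p′ q′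
⇛-ren⁻¹ f (app (lam s) t) (β p q refl) refl with ⇛-ren⁻¹ (Maybe.map f) s p refl | ⇛-ren⁻¹ f t q refl
... | s′ , refl , p′ | t′ , refl , q′ = s′ [ t′ ] , sym (ren-inst s′ t′) , β p′ q′ refl

-- The body of an η-redex is itself a β-redex exactly when the contractum is an abstraction.
data EtaBody {V : Set} (r : Λ V) (p : Λ (Maybe V)) : Set where
  inner : ∀ {r′} → p ≡ app (wk r′) (var nothing) → r ⇛ r′ → EtaBody r p
  redex : ∀ {q} → r ≡ lam q → q ⇛ p → EtaBody r p

η-body : (r : Λ V) {u p : Λ (Maybe V)} → u ⇛ p → u ≡ app (wk r) (var nothing) → EtaBody r p
η-body r (app p (var nothing)) refl with ⇛-ren⁻¹ just r p refl
... | r′ , refl , p′ = inner refl p′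
η-body (lam q) (β p (var nothing) refl) refl with ⇛-ren⁻¹ (Maybe.map just) q p refl
... | q′ , refl , p′ = redex refl (subst (q ⇛_) (sym (map-just-inst q′)) p′)

size : Λ V → ℕ
size (var x) = 1
size (lam t) = suc (size t)
size (app s t) = suc (size s + size t)

size-ren : (f : V → W) (t : Λ V) → size (ren f t) ≡ size t
size-ren f (var x) = refl
size-ren f (lam t) = cong suc (size-ren (Maybe.map f) t)
size-ren f (app s t) = cong suc (cong₂ _+_ (size-ren f s) (size-ren f t))

Joinable : Λ V → Λ V → Set
Joinable a b = ∃ λ c → a ⇛ c × b ⇛ c

size-η : (r : Λ V) → suc (size r) ≤ size (app (wk r) (var nothing))
size-η r = s≤s (≤-trans (m≤m+n (size r) 1) (≤-reflexive (cong (_+ 1) (sym (size-ren just r)))))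

mutual
  -- The critical pair of an η-contraction with a step in the body. If that step was a β-step, `r`
  -- is an abstraction and the pair reduces to a peak at `r` itself.
  diamond-lam-η : ∀ n (r : Λ V) {p a} → suc (size r) ≤ n →
    app (wk r) (var nothing) ⇛ p → r ⇛ a → Joinable (lam p) a
  diamond-lam-η (suc n) r (s≤s h) p q with η-body r p refl
  ... | redex refl p′ = diamond n r h (lam p′) q
  ... | inner refl p′ with diamond n r h p′ q
  ...   | c , p″ , q′ = c , η refl p″ , q′

  -- The critical pair of a β-contraction with separate steps in function and argument; the function
  -- step may be an η-contraction that destroys the β-redex.
  diamond-app-β : ∀ n (s : Λ (Maybe V)) (t : Λ V) {p t₁ s₂ t₂} → size s + size t < n →
    lam s ⇛ p → t ⇛ t₁ → s ⇛ s₂ → t ⇛ t₂ → Joinable (app p t₁) (s₂ [ t₂ ])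
  diamond-app-β (suc n) s t (s≤s h) (lam p) q p₂ q₂
    with diamond n s (≤-trans (m≤m+n _ _) h) p p₂ | diamond n t (≤-trans (m≤n+m _ _) h) q q₂
  ... | c , x , x₂ | d , y , y₂ = c [ d ] , β x y refl , ⇛-inst x₂ y₂
  diamond-app-β (suc n) s t (s≤s h) (η {r = r} refl p) q p₂ q₂ with η-body r p₂ refl
  -- Here `r` is `lam r₀`, so the same peak arises again with the smaller body `r₀`.
  ... | redex {q = r₀} refl p₃ = diamond-app-β n r₀ t
          (≤-trans (+-monoˡ-≤ (size t) (≤-trans (n≤1+n _) (size-η r))) h) p q p₃ q₂
  ... | inner {r′ = r′} refl p₃
    with diamond n r (≤-trans (≤-trans (n≤1+n _) (size-η r)) (≤-trans (m≤m+n _ _) h)) p p₃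
       | diamond n t (≤-trans (m≤n+m _ _) h) q q₂
  ...   | c , x , x₂ | d , y , y₂ =
    app c d , app x y , app (subst (_⇛ c) (sym (wk-inst r′)) x₂) y₂

  -- The induction is on a bound for the size: the function part of an η-redex is recovered from its
  -- weakening and is not a structural subterm.
  diamond : ∀ n (t : Λ V) {a b} → size t ≤ n → t ⇛ a → t ⇛ b → Joinable a b
  diamond n (var x) h (var _) (var _) = var x , var x , var x
  diamond (suc n) (lam s) (s≤s h) (lam p) (lam q) with diamond n s h p q
  ... | c , x , y = lam c , lam x , lam y
  diamond (suc n) (lam s) (s≤s h) (lam p) (η {r = r} refl q) =
    diamond-lam-η n r (≤-trans (size-η r) h) p q
  diamond (suc n) (lam s) (s≤s h) (η {r = r} refl q) (lam p) =
    map₂ swap (diamond-lam-η n r (≤-trans (size-η r) h) p q)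
  diamond (suc n) (lam s) (s≤s h) (η {r = r} refl p) (η e q) with wk-injective (proj₁ (app-injective e))
  ... | refl = diamond n r (≤-trans (≤-trans (n≤1+n _) (size-η r)) h) p q
  diamond (suc n) (app s t) (s≤s h) (app p q) (app p₂ q₂)
    with diamond n s (≤-trans (m≤m+n _ _) h) p p₂ | diamond n t (≤-trans (m≤n+m _ _) h) q q₂
  ... | c , x , x₂ | d , y , y₂ = app c d , app x y , app x₂ y₂
  diamond (suc n) (app (lam s) t) (s≤s h) (app p q) (β p₂ q₂ refl) =
    diamond-app-β n s t h p q p₂ q₂
  diamond (suc n) (app (lam s) t) (s≤s h) (β p₂ q₂ refl) (app p q) =
    map₂ swap (diamond-app-β n s t h p q p₂ q₂)
  diamond (suc n) (app (lam s) t) (s≤s h) (β p q refl) (β p₂ q₂ refl)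
    with diamond n s (≤-trans (≤-trans (n≤1+n _) (m≤m+n _ _)) h) p p₂
       | diamond n t (≤-trans (m≤n+m _ _) h) q q₂
  ... | c , x , x₂ | d , y , y₂ = c [ d ] , ⇛-inst x y , ⇛-inst x₂ y₂

-- Convertibility.

infix 4 _⇛*_ _≃_

_⇛*_ : Λ V → Λ V → Set
_⇛*_ = Star _⇛_

strip : {a b c : Λ V} → a ⇛ b → a ⇛* c → ∃ λ d → b ⇛* d × c ⇛ d
strip {b = b} p ε = b , ε , p
strip {a = a} p (q ◅ qs) with diamond (size a) a ≤-refl p q
... | d , x , y with strip y qs
...   | e , xs , z = e , x ◅ xs , z

⇛-confluent : Confluent (_⇛_ {V})
⇛-confluent {C = c} ε qs = c , qs , ε
⇛-confluent (p ◅ ps) qs with strip p qs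
... | d , xs , y with ⇛-confluent ps xs
...   | e , us , vs = e , us , y ◅ vs

-- Convertibility as joinability: transitivity then costs confluence, but an inversion only has to
-- follow two reduction sequences.
_≃_ : Λ V → Λ V → Set
a ≃ b = ∃ λ c → a ⇛* c × b ⇛* c

≃-refl : {a : Λ V} → a ≃ a
≃-refl = _ , ε , ε

≃-reflexive : {a b : Λ V} → a ≡ b → a ≃ b
≃-reflexive refl = ≃-refl

≃-sym : {a b : Λ V} → a ≃ b → b ≃ a
≃-sym (c , p , q) = c , q , p

≃-trans : {a b c : Λ V} → a ≃ b → b ≃ c → a ≃ c
≃-trans (x , p , q) (y , r , s) with ⇛-confluent q r
... | z , u , v = z , p ◅◅ u , s ◅◅ v

⇛⇒≃ : {a b : Λ V} → a ⇛ b → a ≃ b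
⇛⇒≃ p = _ , p ◅ ε , ε

≃-lam : {a b : Λ (Maybe V)} → a ≃ b → lam a ≃ lam b
≃-lam (c , p , q) = lam c , gmap lam lam p , gmap lam lam q

⇛*-app : {a a′ b b′ : Λ V} → a ⇛* a′ → b ⇛* b′ → app a b ⇛* app a′ b′
⇛*-app {a′ = a′} {b = b} p q =
  gmap (λ z → app z b) (λ r → app r (⇛-refl b)) p ◅◅ gmap (app a′) (app (⇛-refl a′)) q

≃-app : {a a′ b b′ : Λ V} → a ≃ a′ → b ≃ b′ → app a b ≃ app a′ b′
≃-app (c , p , q) (d , r , s) = app c d , ⇛*-app p r , ⇛*-app q s

≃-ren : (f : V → W) {a b : Λ V} → a ≃ b → ren f a ≃ ren f b
≃-ren f (c , p , q) = ren f c , gmap (ren f) (⇛-ren f) p , gmap (ren f) (⇛-ren f) q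

≃-β : (s : Λ (Maybe V)) (t : Λ V) → app (lam s) t ≃ s [ t ]
≃-β s t = ⇛⇒≃ (β (⇛-refl s) (⇛-refl t) refl)

≃-η : (t : Λ V) → lam (app (wk t) (var nothing)) ≃ t
≃-η t = ⇛⇒≃ (η refl (⇛-refl t))

-- Because of η, a reduct of an abstraction need not be an abstraction. Instead of inverting
-- reductions, both sides are weakened, applied to the new variable and β-reduced.
≃-lam-injective : {s t : Λ (Maybe V)} → lam s ≃ lam t → s ≃ t
≃-lam-injective {s = s} {t} e =
  ≃-trans (≃-sym (η-β s)) (≃-trans (≃-app (≃-ren just e) ≃-refl) (η-β t))
  where
  η-β : (s : Λ (Maybe V)) → app (wk (lam s)) (var nothing) ≃ s
  η-β s = ≃-trans (≃-β _ _) (≃-reflexive (map-just-inst s))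

-- Spines

apps : Λ V → List (Λ V) → Λ V
apps = foldl app

≃-apps : {s t : Λ V} → s ≃ t → (us : List (Λ V)) → apps s us ≃ apps t us
≃-apps e [] = e
≃-apps e (u ∷ us) = ≃-apps (≃-app e ≃-refl) us

ren-apps : (f : V → W) (h : Λ V) (ts : List (Λ V)) → ren f (apps h ts) ≡ apps (ren f h) (map (ren f) ts)
ren-apps f h [] = refl
ren-apps f h (t ∷ ts) = ren-apps f (app h t) ts

Occ-apps-head : {x : V} {h : Λ V} (ts : List (Λ V)) → Occ x h → Occ x (apps h ts)
Occ-apps-head [] o = o
Occ-apps-head (t ∷ ts) o = Occ-apps-head ts (inj₁ o)

-- A left inverse of `apps` on variable heads, from which follow injectivity of spines and their
-- difference from abstractions.
unapps : Λ V → List (Λ V) → Λ V × List (Λ V)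
unapps (app s t) us = unapps s (t ∷ us)
unapps s us = s , us

unapps-apps : (h : Λ V) (ts us : List (Λ V)) → unapps (apps h ts) us ≡ unapps h (ts ++ us)
unapps-apps h [] us = refl
unapps-apps h (t ∷ ts) us = unapps-apps (app h t) ts us

unapps-var : (x : V) (ts : List (Λ V)) → unapps (apps (var x) ts) [] ≡ (var x , ts)
unapps-var x ts = trans (unapps-apps (var x) ts []) (cong (var x ,_) (++-identityʳ ts))

apps-injective : {x y : V} (ts us : List (Λ V)) → apps (var x) ts ≡ apps (var y) us → x ≡ y × ts ≡ us
apps-injective {x = x} {y} ts us e = var-injective (cong proj₁ e′) , cong proj₂ e′
  where e′ = trans (sym (unapps-var x ts)) (trans (cong (λ z → unapps z []) e) (unapps-var y us))

apps≢lam : {x : V} (ts : List (Λ V)) {s : Λ (Maybe V)} → ¬ apps (var x) ts ≡ lam s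
apps≢lam {x = x} ts e with trans (sym (unapps-var x ts)) (cong (λ z → unapps z []) e)
... | ()

-- The successor of this bound indexes a fresh atom. Bound variables get weight 0, which leaves the
-- maximum unchanged.
maxName : (V → ℕ) → Λ V → ℕ
maxName w (var x) = w x
maxName w (lam t) = maxName (maybe′ w 0) t
maxName w (app s t) = maxName w s ⊔ maxName w t

Occ⇒≤maxName : (w : V → ℕ) {x : V} (t : Λ V) → Occ x t → w x ≤ maxName w t
Occ⇒≤maxName w (var y) refl = ≤-refl
Occ⇒≤maxName w (lam t) o = Occ⇒≤maxName (maybe′ w 0) t o
Occ⇒≤maxName w (app s t) (inj₁ o) = ≤-trans (Occ⇒≤maxName w s o) (m≤m⊔n _ _)
Occ⇒≤maxName w (app s t) (inj₂ o) = ≤-trans (Occ⇒≤maxName w t o) (m≤n⊔m _ _)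

-- Reduction of variable-headed spines.

data Rigid {V : Set} : Λ V → Set where
  var : ∀ x → Rigid (var x)
  app : ∀ {s} → Rigid s → ∀ t → Rigid (app s t)

Rigid-⇛ : {s s′ : Λ V} → Rigid s → s ⇛ s′ → Rigid s′
Rigid-⇛ (var x) (var _) = var x
Rigid-⇛ (app r t) (app {t′ = t′} p q) = app (Rigid-⇛ r p) t′
Rigid-⇛ (app () t) (β p q e)

var-⇛* : {x : V} {p : Λ V} → var x ⇛* p → p ≡ var x
var-⇛* ε = refl
var-⇛* (var _ ◅ ps) = var-⇛* ps

-- A rigid function part is never an abstraction and stays rigid, so every step is a congruence.
Rigid-app-⇛* : {s t p : Λ V} → Rigid s → app s t ⇛* p → ∃₂ λ s′ t′ → p ≡ app s′ t′ × s ⇛* s′ × t ⇛* t′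
Rigid-app-⇛* r ε = _ , _ , refl , ε , ε
Rigid-app-⇛* r (app p q ◅ ps) with Rigid-app-⇛* (Rigid-⇛ r p) ps
... | s′ , t′ , e , p′ , q′ = s′ , t′ , e , p ◅ p′ , q ◅ q′
Rigid-app-⇛* () (β _ _ _ ◅ _)

module Nominal (S : Signature) where
  open Signature S

  -- η-long normal forms; only the sorts of the arguments a head expects matter,
  -- so a context is described by an arity function.
  mutual
    data Long {V : Set} (ar : V → List (Sort S)) : Sort S → Λ V → Set where
      atm : ∀ {ν t} → Neut ar t [] → Long ar (atmS ν) t
      dat : ∀ {δ t} → Neut ar t [] → Long ar (datS δ) t
      abs : ∀ {ν τ t} → Long (maybe′ ar []) τ t → Long ar (absS ν τ) (lam t)

    data Neut {V : Set} (ar : V → List (Sort S)) : Λ V → List (Sort S) → Set where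
      var : ∀ x → Neut ar (var x) (ar x)
      app : ∀ {t u τ τs} → Neut ar t (τ ∷ τs) → Long ar τ u → Neut ar (app t u) τs

  Neut⇒Rigid : {ar : V → List (Sort S)} {t : Λ V} {τs : List (Sort S)} → Neut ar t τs → Rigid t
  Neut⇒Rigid (var x) = var x
  Neut⇒Rigid (app n _) = app (Neut⇒Rigid n) _

  mutual
    -- The sort decides between an abstraction and a neutral term, so no η-step is left to reconcile
    -- the two sides.
    Long-unique : {ar : V → List (Sort S)} {τ : Sort S} {s t : Λ V} →
      Long ar τ s → Long ar τ t → s ≃ t → s ≡ t
    Long-unique (atm m) (atm n) e = proj₁ (Neut-unique m n e)
    Long-unique (dat m) (dat n) e = proj₁ (Neut-unique m n e)
    Long-unique (abs m) (abs n) e = cong lam (Long-unique m n (≃-lam-injective e))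

    -- The equality of pending sorts is proved along the way because it puts the next two arguments
    -- at a common sort, as `Long-unique` requires.
    Neut-unique : {ar : V → List (Sort S)} {σs τs : List (Sort S)} {s t : Λ V} →
      Neut ar s σs → Neut ar t τs → s ≃ t → s ≡ t × σs ≡ τs
    Neut-unique (var x) (var y) (_ , p , q) with trans (sym (var-⇛* p)) (var-⇛* q)
    ... | refl = refl , refl
    Neut-unique (var x) (app n _) (_ , p , q) with var-⇛* p | Rigid-app-⇛* (Neut⇒Rigid n) q
    ... | refl | _ , _ , () , _
    Neut-unique (app m _) (var x) (_ , p , q) with Rigid-app-⇛* (Neut⇒Rigid m) p | var-⇛* q
    ... | _ , _ , () , _ | refl
    Neut-unique (app m k) (app n l) (_ , p , q)
      with Rigid-app-⇛* (Neut⇒Rigid m) p | Rigid-app-⇛* (Neut⇒Rigid n) q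
    ... | a , b , refl , p₁ , p₂ | _ , _ , refl , q₁ , q₂ with Neut-unique m n (a , p₁ , q₁)
    ...   | refl , refl with Long-unique k l (b , p₂ , q₂)
    ...     | refl = refl , refl

  mutual
    Long-ren : {ar : V → List (Sort S)} {ar′ : W → List (Sort S)} {f : V → W} →
      (∀ x → ar′ (f x) ≡ ar x) → {τ : Sort S} {t : Λ V} → Long ar τ t → Long ar′ τ (ren f t)
    Long-ren e (atm n) = atm (Neut-ren e n)
    Long-ren e (dat n) = dat (Neut-ren e n)
    Long-ren e (abs l) = abs (Long-ren (λ { nothing → refl ; (just x) → e x }) l)

    Neut-ren : {ar : V → List (Sort S)} {ar′ : W → List (Sort S)} {f : V → W} →
      (∀ x → ar′ (f x) ≡ ar x) → {τs : List (Sort S)} {t : Λ V} → Neut ar t τs → Neut ar′ (ren f t) τs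
    Neut-ren {f = f} e (var x) = subst (Neut _ _) (e x) (var (f x))
    Neut-ren e (app n l) = app (Neut-ren e n) (Long-ren e l)

  -- Nominal terms as λ-terms

  data Name : Set where
    atm : Atom S → Name
    gv  : Var S → Name
    fn  : Fun → Name

  atm-injective : ∀ {a b} → Name.atm a ≡ atm b → a ≡ b
  atm-injective refl = refl

  arity : Name → List (Sort S)
  arity (fn f) = argSorts f
  arity _ = []

  -- Captures the atom as the newest bound variable: `lam` after `ren (bind a)` is abstraction over
  -- a named variable.
  bind : Atom S → Name → Maybe Name
  bind a (atm b) = if does (_≟_ S a b) then nothing else just (atm b)
  bind a x = just x

  bind-same : ∀ a → bind a (atm a) ≡ nothing
  bind-same a rewrite dec-true (_≟_ S a a) refl = refl

  bind-other : ∀ {a b} → ¬ a ≡ b → bind a (atm b) ≡ just (atm b)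
  bind-other {a} {b} a≢b rewrite dec-false (_≟_ S a b) a≢b = refl

  bind-fresh : ∀ {a x} → ¬ x ≡ atm a → bind a x ≡ just x
  bind-fresh {x = atm b} x≢a = bind-other λ { refl → x≢a refl }
  bind-fresh {x = gv X} _ = refl
  bind-fresh {x = fn f} _ = refl

  arity-bind : ∀ a x → maybe′ arity [] (bind a x) ≡ arity x
  arity-bind a (atm b) with _≟_ S a b
  ... | yes _ = refl
  ... | no _ = refl
  arity-bind a (gv X) = refl
  arity-bind a (fn f) = refl

  unbind : Atom S → Maybe Name → Name
  unbind a = maybe′ id (atm a)

  unbind-bind : ∀ a s → ren (unbind a) (ren (bind a) s) ≡ s
  unbind-bind a s = trans (ren-ren s) (ren-id pointwise s)
    where
    pointwise : ∀ x → unbind a (bind a x) ≡ x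
    pointwise (atm b) with _≟_ S a b
    ... | yes refl = refl
    ... | no _ = refl
    pointwise (gv X) = refl
    pointwise (fn f) = refl

  mutual
    -- The reading of suspensions is a parameter, so that `code` below and `embθ`, which uses the
    -- λ-solution, share one traversal.
    emb : (Perm S → Var S → Λ Name) → Term S → Λ Name
    emb φ (fun f ts) = apps (var (fn f)) (embs φ ts)
    emb φ (atom a) = var (atm a)
    emb φ (abs a t) = lam (ren (bind a) (emb φ t))
    emb φ (susp π X) = φ π X

    embs : (Perm S → Var S → Λ Name) → List (Term S) → List (Λ Name)
    embs φ [] = []
    embs φ (t ∷ ts) = emb φ t ∷ embs φ ts

  -- Forgetting the permutation of a suspension is harmless here: the freshness
  -- environment will make all relevant atoms fresh for all relevant variables.
  code : Term S → Λ Name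
  code = emb λ _ X → var (gv X)

  codes : List (Term S) → List (Λ Name)
  codes = embs λ _ X → var (gv X)

  -- Permutations acting on codes.

  swapAtom-left : ∀ a b → swapAtom S (a , b) a ≡ b
  swapAtom-left a b rewrite dec-true (_≟_ S a a) refl = refl

  swapAtom-right : ∀ a b → swapAtom S (a , b) b ≡ a
  swapAtom-right a b with _≟_ S b a
  ... | yes refl = refl
  ... | no _ rewrite dec-true (_≟_ S b b) refl = refl

  swapAtom-other : ∀ {a b c} → ¬ c ≡ a → ¬ c ≡ b → swapAtom S (a , b) c ≡ c
  swapAtom-other {a} {b} {c} c≢a c≢b
    rewrite dec-false (_≟_ S c a) c≢a | dec-false (_≟_ S c b) c≢b = refl

  swapAtom-involutive : ∀ s c → swapAtom S s (swapAtom S s c) ≡ c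
  swapAtom-involutive (a , b) c with _≟_ S c a
  ... | yes refl = swapAtom-right c b
  ... | no c≢a with _≟_ S c b
  ...   | yes refl = swapAtom-left a c
  ...   | no c≢b = swapAtom-other c≢a c≢b

  act-injective : ∀ π {a b} → act S π a ≡ act S π b → a ≡ b
  act-injective [] e = e
  act-injective (s ∷ π) e = act-injective π
    (trans (sym (swapAtom-involutive s _)) (trans (cong (swapAtom S s) e) (swapAtom-involutive s _)))

  actName : Perm S → Name → Name
  actName π (atm a) = atm (act S π a)
  actName π x = x

  arity-actName : ∀ π x → arity (actName π x) ≡ arity x
  arity-actName π (atm a) = refl
  arity-actName π (gv X) = refl
  arity-actName π (fn f) = refl

  bind-actName : ∀ π a x → bind (act S π a) (actName π x) ≡ Maybe.map (actName π) (bind a x)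
  bind-actName π a (atm b) with _≟_ S a b
  ... | yes refl = bind-same (act S π a)
  ... | no a≢b = bind-other (a≢b ∘ act-injective π)
  bind-actName π a (gv X) = refl
  bind-actName π a (fn f) = refl

  mutual
    -- Binders are respected because the action on atoms is injective. At suspensions both sides are
    -- the bare variable, which `actName` fixes.
    code-act : ∀ π t → code (_∙_ S π t) ≡ ren (actName π) (code t)
    code-act π (fun f ts) =
      trans (cong (apps _) (codes-act π ts)) (sym (ren-apps (actName π) (var (fn f)) (codes ts)))
    code-act π (atom a) = refl
    code-act π (abs a t) = cong lam (trans (cong (ren _) (code-act π t))
      (trans (ren-ren (code t)) (trans (ren-cong (bind-actName π a) (code t)) (sym (ren-ren (code t))))))
    code-act π (susp π′ X) = refl

    codes-act : ∀ π ts → codes (_∙s_ S π ts) ≡ map (ren (actName π)) (codes ts)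
    codes-act π [] = refl
    codes-act π (t ∷ ts) = cong₂ _∷_ (code-act π t) (codes-act π ts)

  mutual
    varsT : Term S → List (Var S)
    varsT (fun f ts) = varsTs ts
    varsT (atom a) = []
    varsT (abs a t) = varsT t
    varsT (susp π X) = X ∷ []

    varsTs : List (Term S) → List (Var S)
    varsTs [] = []
    varsTs (t ∷ ts) = varsT t ++ varsTs ts

  -- α-equivalence from equality of codes

  module _ (L : List (Atom S)) (Xs : List (Var S)) where

    PermWithin : Perm S → Set
    PermWithin = All λ s → proj₁ s ∈ L × proj₂ s ∈ L

    mutual
      -- The invariant that lets `∇` below supply every constraint asked for. It survives the
      -- swapping introduced by `≈abs≠`.
      Within : Term S → Set
      Within (fun f ts) = Withins ts
      Within (atom a) = a ∈ L
      Within (abs a t) = a ∈ L × Within t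
      Within (susp π X) = PermWithin π × X ∈ Xs

      Withins : List (Term S) → Set
      Withins [] = ⊤
      Withins (t ∷ ts) = Within t × Withins ts

    PermWithin-⊆ : ∀ π → atomsPerm S π ⊆ L → PermWithin π
    PermWithin-⊆ [] _ = []
    PermWithin-⊆ (_ ∷ π) h =
      (h (here refl) , h (there (here refl))) ∷ PermWithin-⊆ π (λ i → h (there (there i)))

    mutual
      Within-⊆ : ∀ t → atomsT S t ⊆ L → varsT t ⊆ Xs → Within t
      Within-⊆ (fun f ts) h k = Withins-⊆ ts h k
      Within-⊆ (atom a) h k = h (here refl)
      Within-⊆ (abs a t) h k = h (here refl) , Within-⊆ t (h ∘ there) k
      Within-⊆ (susp π X) h k = PermWithin-⊆ π h , k (here refl)

      Withins-⊆ : ∀ ts → atomsTs S ts ⊆ L → varsTs ts ⊆ Xs → Withins ts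
      Withins-⊆ [] h k = tt
      Withins-⊆ (t ∷ ts) h k = Within-⊆ t (h ∘ ∈-++⁺ˡ) (k ∘ ∈-++⁺ˡ) ,
        Withins-⊆ ts (h ∘ ∈-++⁺ʳ (atomsT S t)) (k ∘ ∈-++⁺ʳ (varsT t))

    swapAtom-∈ : ∀ {a b c} → a ∈ L → b ∈ L → c ∈ L → swapAtom S (a , b) c ∈ L
    swapAtom-∈ {a} {b} {c} a∈ b∈ c∈ with _≟_ S c a
    ... | yes _ = b∈
    ... | no _ with _≟_ S c b
    ...   | yes _ = a∈
    ...   | no _ = c∈

    act-∈ : ∀ {π c} → PermWithin π → c ∈ L → act S π c ∈ L
    act-∈ [] c∈ = c∈
    act-∈ ((a∈ , b∈) ∷ h) c∈ = swapAtom-∈ a∈ b∈ (act-∈ h c∈)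

    act-∉ : ∀ {π c} → PermWithin π → ¬ c ∈ L → act S π c ≡ c
    act-∉ [] c∉ = refl
    act-∉ ((a∈ , b∈) ∷ h) c∉ = trans (cong (swapAtom S _) (act-∉ h c∉))
      (swapAtom-other (λ { refl → c∉ a∈ }) (λ { refl → c∉ b∈ }))

    -- Both permutations fix every atom outside `L`, so they disagree only inside it. This covers
    -- the premise of `≈susp`.
    moved-∈ : ∀ {π π′ c} → PermWithin π → PermWithin π′ → ¬ act S π c ≡ act S π′ c → c ∈ L
    moved-∈ {c = c} h h′ moved with Any.any? (_≟_ S c) L
    ... | yes c∈ = c∈
    ... | no c∉ = contradiction (trans (act-∉ h c∉) (sym (act-∉ h′ c∉))) moved

    mutual
      Within-act : ∀ {π} → PermWithin π → ∀ t → Within t → Within (_∙_ S π t)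
      Within-act h (fun f ts) w = Withins-act h ts w
      Within-act h (atom a) w = act-∈ h w
      Within-act h (abs a t) (a∈ , w) = act-∈ h a∈ , Within-act h t w
      Within-act h (susp π′ X) (h′ , X∈) = AllP.++⁺ h h′ , X∈

      Withins-act : ∀ {π} → PermWithin π → ∀ ts → Withins ts → Withins (_∙s_ S π ts)
      Withins-act h [] w = tt
      Withins-act h (t ∷ ts) (w , ws) = Within-act h t w , Withins-act h ts ws

    private
      ∇ : FreshEnv S
      ∇ = cartesianProduct L Xs

    mutual
      -- Codes of suspensions mention no atom, so non-occurrence says nothing there; the constraint
      -- is found in `∇` instead.
      ¬Occ⇒# : ∀ {a} → a ∈ L → ∀ t → Within t → ¬ Occ (atm a) (code t) → _⊢_#_ S ∇ a t
      ¬Occ⇒# a∈ (fun f ts) w o = #fun (¬Occ⇒#s a∈ (var (fn f)) ts w o)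
      ¬Occ⇒# a∈ (atom b) w o = #atom λ { refl → o refl }
      ¬Occ⇒# {a} a∈ (abs b t) (_ , w) o with _≟_ S b a
      ... | yes refl = #abs=
      ... | no b≢a = #abs≠ (b≢a ∘ sym) (¬Occ⇒# a∈ t w λ o′ →
        o (subst (λ z → Occ z (ren (bind b) (code t))) (bind-other b≢a) (Occ-ren (bind b) (code t) o′)))
      ¬Occ⇒# a∈ (susp π X) (h , X∈) o =
        -- The inverse permutation is the reversed list, whose swappings are still over `L`.
        #susp (∈-cartesianProduct⁺ (act-∈ (All.tabulate (All.lookup h ∘ AnyP.reverse⁻)) a∈) X∈)

      ¬Occ⇒#s : ∀ {a} → a ∈ L → ∀ h ts → Withins ts → ¬ Occ (atm a) (apps h (codes ts)) →
        All (_⊢_#_ S ∇ a) ts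
      ¬Occ⇒#s a∈ h [] w o = []
      ¬Occ⇒#s a∈ h (t ∷ ts) (w , ws) o =
        ¬Occ⇒# a∈ t w (o ∘ Occ-apps-head (codes ts) ∘ inj₂) ∷ ¬Occ⇒#s a∈ (app h (code t)) ts ws o

    module _ {a b : Atom S} (a≢b : ¬ a ≡ b) {s t : Λ Name} (e : ren (bind a) s ≡ ren (bind b) t) where

      -- An occurrence of `a` in `t` would stay free under `bind b`, whereas `bind a` leaves no free
      -- `a`.
      bind-≡⇒¬Occ : ¬ Occ (atm a) t
      bind-≡⇒¬Occ o with Occ-ren⁻¹ (bind a) s (subst (Occ _) (sym e) (Occ-ren (bind b) t o))
      ... | atm c , _ , q with _≟_ S a c
      ...   | yes refl = case trans (sym (bind-other (a≢b ∘ sym))) q of λ ()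
      ...   | no a≢c = a≢c (atm-injective (just-injective (trans (sym (bind-other (a≢b ∘ sym))) q)))
      bind-≡⇒¬Occ o | gv X , _ , q = case trans (sym (bind-other (a≢b ∘ sym))) q of λ ()
      bind-≡⇒¬Occ o | fn f , _ , q = case trans (sym (bind-other (a≢b ∘ sym))) q of λ ()

      -- Reopening the common body with `a` gives `s` on one side. On the other it sends `b` to `a`
      -- and fixes the remaining names of `t`, exactly as the swapping does because `a` does not
      -- occur.
      bind-≡⇒swap : s ≡ ren (actName ((a , b) ∷ [])) t
      bind-≡⇒swap = trans (sym (unbind-bind a s)) (trans (cong (ren (unbind a)) e) (trans (ren-ren t)
        (ren-cong-Occ t unbind-swap)))
        where
        unbind-swap : ∀ x → Occ x t → unbind a (bind b x) ≡ actName ((a , b) ∷ []) x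
        unbind-swap (atm c) o with _≟_ S b c
        ... | yes refl = cong atm (sym (swapAtom-right a b))
        ... | no b≢c = cong atm (sym (swapAtom-other (λ { refl → bind-≡⇒¬Occ o }) (b≢c ∘ sym)))
        unbind-swap (gv X) o = refl
        unbind-swap (fn f) o = refl

    mutual
      -- The recursion is on the first term, since under distinct binders the second one is
      -- permuted.
      code-≡⇒≈ : ∀ t u → Within t → Within u → code t ≡ code u → _⊢_≈_ S ∇ t u
      code-≡⇒≈ (fun f ts) (fun g us) w v e with apps-injective (codes ts) (codes us) e
      ... | refl , e′ = ≈fun (codes-≡⇒≈ ts us w v e′)
      code-≡⇒≈ (fun f ts) (atom a) w v e = case proj₁ (apps-injective (codes ts) [] e) of λ ()
      code-≡⇒≈ (fun f ts) (abs a u) w v e = contradiction e (apps≢lam (codes ts))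
      code-≡⇒≈ (fun f ts) (susp π X) w v e = case proj₁ (apps-injective (codes ts) [] e) of λ ()
      code-≡⇒≈ (atom a) (fun f us) w v e = case proj₁ (apps-injective [] (codes us) e) of λ ()
      code-≡⇒≈ (atom a) (atom b) w v refl = ≈atom
      code-≡⇒≈ (abs a t) (fun f us) w v e = contradiction (sym e) (apps≢lam (codes us))
      code-≡⇒≈ (abs a t) (abs b u) (a∈ , w) (b∈ , v) e with _≟_ S a b
      ... | no a≢b = ≈abs≠ a≢b
        (code-≡⇒≈ t (_∙_ S ((a , b) ∷ []) u) w (Within-act ((a∈ , b∈) ∷ []) u v)
          (trans (bind-≡⇒swap a≢b (lam-injective e)) (sym (code-act ((a , b) ∷ []) u))))
        (¬Occ⇒# a∈ u v (bind-≡⇒¬Occ a≢b (lam-injective e)))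
      ... | yes refl = ≈abs= (code-≡⇒≈ t u w v
        (trans (sym (unbind-bind a (code t))) (trans (cong (ren (unbind a)) (lam-injective e)) (unbind-bind a (code u)))))
      code-≡⇒≈ (susp π X) (fun f us) w v e = case proj₁ (apps-injective [] (codes us) e) of λ ()
      -- Equal codes identify only the variable; the difference of the permutations is absorbed by
      -- `∇`.
      code-≡⇒≈ (susp π X) (susp π′ X) (h , X∈) (h′ , _) refl = ≈susp λ c c≢ → ∈-cartesianProduct⁺ (moved-∈ h h′ c≢) X∈

      codes-≡⇒≈ : ∀ ts us → Withins ts → Withins us → codes ts ≡ codes us → Pointwise (_⊢_≈_ S ∇) ts us
      codes-≡⇒≈ [] [] w v e = []
      codes-≡⇒≈ (t ∷ ts) (u ∷ us) (w , ws) (v , vs) e =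
        code-≡⇒≈ t u w v (∷-injectiveˡ e) ∷ codes-≡⇒≈ ts us ws vs (∷-injectiveʳ e)

  -- Evaluation of λ-terms with metavariables

  -- Indices, metavariables and constants are treated alike, so one environment both names a context
  -- by atoms and instantiates metavariables.
  data Head (M : Set) : Set where
    ix  : ℕ → Head M
    fv  : M → Head M
    con : Fun → Head M

  Env : Set → Set → Set
  Env M V = Head M → Λ V

  module _ {M : Set} where

    liftEnv : Env M V → Env M (Maybe V)
    liftEnv e (ix zero) = var nothing
    liftEnv e (ix (suc i)) = wk (e (ix i))
    liftEnv e (fv F) = wk (e (fv F))
    liftEnv e (con f) = wk (e (con f))

    consEnv : Λ V → Env M V → Env M V
    consEnv u e (ix zero) = u
    consEnv u e (ix (suc i)) = e (ix i)
    consEnv u e (fv F) = e (fv F)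
    consEnv u e (con f) = e (con f)

    eval : Env M V → LTm S M → Λ V
    eval e (var i) = e (ix i)
    eval e (fv F) = e (fv F)
    eval e (con f) = e (con f)
    eval e (lam A t) = lam (eval (liftEnv e) t)
    eval e (s · t) = app (eval e s) (eval e t)

    eval-cong : {e e′ : Env M V} → (∀ h → e h ≡ e′ h) → ∀ t → eval e t ≡ eval e′ t
    eval-cong q (var i) = q (ix i)
    eval-cong q (fv F) = q (fv F)
    eval-cong q (con f) = q (con f)
    eval-cong q (lam A t) = cong lam (eval-cong (λ where
      (ix zero) → refl
      (ix (suc i)) → cong wk (q (ix i))
      (fv F) → cong wk (q (fv F))
      (con f) → cong wk (q (con f))) t)
    eval-cong q (s · t) = cong₂ app (eval-cong q s) (eval-cong q t)

    -- Typing bounds the indices that occur. In the empty context, values at indices cannot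
    -- influence the result.
    eval-cong-Typed : {tyM : M → Ty S} {Γ : List (Ty S)} {t : LTm S M} {A : Ty S} {e e′ : Env M V} →
      (∀ {i B} → _∋_∶_ S Γ i B → e (ix i) ≡ e′ (ix i)) →
      (∀ F → e (fv F) ≡ e′ (fv F)) → (∀ f → e (con f) ≡ e′ (con f)) →
      Typed S tyM Γ t A → eval e t ≡ eval e′ t
    eval-cong-Typed p q r (var i) = p i
    eval-cong-Typed p q r (fv F) = q F
    eval-cong-Typed p q r (con f) = r f
    eval-cong-Typed p q r (lam d) =
      cong lam (eval-cong-Typed (λ { here → refl ; (there i) → cong wk (p i) }) (cong wk ∘ q) (cong wk ∘ r) d)
    eval-cong-Typed p q r (app d d′) = cong₂ app (eval-cong-Typed p q r d) (eval-cong-Typed p q r d′)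

    ren-eval : {f : V → W} {e : Env M V} (t : LTm S M) → ren f (eval e t) ≡ eval (ren f ∘ e) t
    ren-eval (var i) = refl
    ren-eval (fv F) = refl
    ren-eval (con f) = refl
    ren-eval {e = e} (lam A t) = cong lam (trans (ren-eval t) (eval-cong (λ where
      (ix zero) → refl
      (ix (suc i)) → map-wk (e (ix i))
      (fv F) → map-wk (e (fv F))
      (con f) → map-wk (e (con f))) t))
    ren-eval (s · t) = cong₂ app (ren-eval s) (ren-eval t)

    sub-eval : {s : V → Λ W} {e : Env M V} (t : LTm S M) → sub s (eval e t) ≡ eval (sub s ∘ e) t
    sub-eval (var i) = refl
    sub-eval (fv F) = refl
    sub-eval (con f) = refl
    sub-eval {e = e} (lam A t) = cong lam (trans (sub-eval t) (eval-cong (λ where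
      (ix zero) → refl
      (ix (suc i)) → lift-wk (e (ix i))
      (fv F) → lift-wk (e (fv F))
      (con f) → lift-wk (e (con f))) t))
    sub-eval (s · t) = cong₂ app (sub-eval s) (sub-eval t)

    eval-lam-inst : {e : Env M V} (t : LTm S M) (u : Λ V) →
      eval (liftEnv e) t [ u ] ≡ eval (consEnv u e) t
    eval-lam-inst {e = e} t u = trans (sub-eval t) (eval-cong (λ where
      (ix zero) → refl
      (ix (suc i)) → wk-inst (e (ix i))
      (fv F) → wk-inst (e (fv F))
      (con f) → wk-inst (e (con f))) t)

    -- The second environment is described pointwise, so that under a binder the same condition can
    -- be re-established for the lifted environments. `eval-bsub` is set up likewise.
    eval-shift : ∀ c {e e′ : Env M V} →
      (∀ i → e′ (ix i) ≡ (if i <ᵇ c then e (ix i) else e (ix (suc i)))) →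
      (∀ F → e′ (fv F) ≡ e (fv F)) → (∀ f → e′ (con f) ≡ e (con f)) →
      ∀ t → eval e (shift S c t) ≡ eval e′ t
    eval-shift c p q r (var i) with i <ᵇ c | p i
    ... | true | p′ = sym p′
    ... | false | p′ = sym p′
    eval-shift c p q r (fv F) = sym (q F)
    eval-shift c p q r (con f) = sym (r f)
    eval-shift c {e} {e′} p q r (lam A t) =
      cong lam (eval-shift (suc c) p′ (cong wk ∘ q) (cong wk ∘ r) t)
      where
      p′ : ∀ i → liftEnv e′ (ix i) ≡ (if i <ᵇ suc c then liftEnv e (ix i) else liftEnv e (ix (suc i)))
      p′ zero = refl
      p′ (suc i) with i <ᵇ c | p i
      ... | true | x = cong wk x
      ... | false | x = cong wk x
    eval-shift c p q r (s · t) = cong₂ app (eval-shift c p q r s) (eval-shift c p q r t)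

    eval-wk : {e : Env M V} (t : LTm S M) → eval (liftEnv e) (shift S zero t) ≡ wk (eval e t)
    eval-wk t = trans (eval-shift zero (λ _ → refl) (λ _ → refl) (λ _ → refl) t) (sym (ren-eval t))

    eval-bsub : ∀ j (u : LTm S M) {e e′ : Env M V} →
      (∀ i → e′ (ix i) ≡ (if i ≡ᵇ j then eval e u else (if i <ᵇ j then e (ix i) else e (ix (pred i))))) →
      (∀ F → e′ (fv F) ≡ e (fv F)) → (∀ f → e′ (con f) ≡ e (con f)) →
      ∀ t → eval e (bsub S j u t) ≡ eval e′ t
    eval-bsub j u p q r (var i) with i ≡ᵇ j | i <ᵇ j | p i
    ... | true | _ | x = sym x
    ... | false | true | x = sym x
    ... | false | false | x = sym x
    eval-bsub j u p q r (fv F) = sym (q F)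
    eval-bsub j u p q r (con f) = sym (r f)
    eval-bsub j u {e} {e′} p q r (lam A t) =
      cong lam (eval-bsub (suc j) (shift S zero u) p′ (cong wk ∘ q) (cong wk ∘ r) t)
      where
      -- In the last branch i > j, so pred i is the honest predecessor.
      unlift : ∀ i j → wk (if i ≡ᵇ j then eval e u else (if i <ᵇ j then e (ix i) else e (ix (pred i)))) ≡
        (if i ≡ᵇ j then wk (eval e u) else (if i <ᵇ j then wk (e (ix i)) else liftEnv e (ix i)))
      unlift zero zero = refl
      unlift zero (suc j) = refl
      unlift (suc i) j with suc i ≡ᵇ j | suc i <ᵇ j
      ... | true | _ = refl
      ... | false | true = refl
      ... | false | false = refl

      p′ : ∀ i → liftEnv e′ (ix i) ≡ (if i ≡ᵇ suc j then eval (liftEnv e) (shift S zero u)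
        else (if i <ᵇ suc j then liftEnv e (ix i) else liftEnv e (ix (pred i))))
      p′ zero = refl
      p′ (suc i) rewrite eval-wk {e = e} u = trans (cong wk (p i)) (unlift i j)
    eval-bsub j u p q r (s · t) = cong₂ app (eval-bsub j u p q r s) (eval-bsub j u p q r t)

    eval-sound : {s t : LTm S M} → _≃βη_ S s t → (e : Env M V) → eval e s ≃ eval e t
    eval-sound (β {s = s} {u}) e = ≃-trans (≃-β _ _) (≃-reflexive (trans (eval-lam-inst s (eval e u))
      (sym (eval-bsub zero u (λ { zero → refl ; (suc i) → refl }) (λ _ → refl) (λ _ → refl) s))))
    eval-sound (η {s = s}) e =
      ≃-trans (≃-reflexive (cong (λ z → lam (app z (var nothing))) (eval-wk s))) (≃-η _)
    eval-sound refl e = ≃-refl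
    eval-sound (_≃βη_.sym p) e = ≃-sym (eval-sound p e)
    eval-sound (_≃βη_.trans p q) e = ≃-trans (eval-sound p e) (eval-sound q e)
    eval-sound (lamc p) e = ≃-lam (eval-sound p (liftEnv e))
    eval-sound (appc p q) e = ≃-app (eval-sound p e) (eval-sound q e)

  -- Reducibility: typed terms denote nominal terms

  Denotes : Sort S → Λ Name → Set
  Denotes τ t = ∃ λ N → _∶ₛ_ S N τ × Long arity τ (code N) × t ≃ code N

  -- A logical relation closed under conversion. Every atom is reducible at its type, so `reify` may
  -- feed a fresh one to a function.
  Red : Ty S → Λ Name → Set
  Red (atomT ν) t = ∃ λ n → t ≃ var (atm (ν , n))
  Red (dataT δ) t = Denotes (datS δ) t
  Red (A ⇒ B) t = ∀ u → Red A u → Red B (app t u)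

  Red-≃ : ∀ A {s t} → s ≃ t → Red A t → Red A s
  Red-≃ (atomT ν) e (n , q) = n , ≃-trans e q
  Red-≃ (dataT δ) e (N , d , l , q) = N , d , l , ≃-trans e q
  Red-≃ (A ⇒ B) e r u ru = Red-≃ B (≃-app e ≃-refl) (r u ru)

  nameIndex : Name → ℕ
  nameIndex (atm a) = proj₂ a
  nameIndex _ = 0

  -- At an abstraction sort the function is applied to a fresh atom, the result is read back and the
  -- atom abstracted; η identifies the outcome with the function.
  reify : ∀ τ t → Red (⟦_⟧ S τ) t → Denotes τ t
  reify (atmS ν) t (n , e) = atom (ν , n) , atom (ν , n) , atm (var _) , e
  reify (datS δ) t r = r
  reify (absS ν τ) t r = abstracted (reify τ _ (r (var (atm c)) (_ , ≃-refl)))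
    where
    c : Atom S
    -- One above the index of every name occurring in `t`.
    c = ν , suc (maxName nameIndex t)

    c-fresh : ∀ x → Occ x t → bind c x ≡ just x
    c-fresh x o = bind-fresh λ { refl → <-irrefl refl (Occ⇒≤maxName nameIndex t o) }

    abstracted : Denotes τ (app t (var (atm c))) → Denotes (absS ν τ) t
    abstracted (N , d , l , e) = abs c N , abs d , abs (Long-ren (arity-bind c) l) ,
      ≃-trans (≃-sym (≃-η t)) (≃-lam (≃-trans
        (≃-reflexive (sym (cong₂ app (ren-cong-Occ t c-fresh) (cong var (bind-same c)))))
        (≃-ren (bind c) e)))

  -- Arguments arrive one by one, while a nominal application takes a whole list: `h` collects the
  -- codes so far, and the continuation builds the term once all arguments are known.
  Red-neutral : ∀ {δ} τs {t} h → t ≃ h → Neut arity h τs →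
    (∀ Ns → Pointwise (_∶ₛ_ S) Ns τs → ∃ λ N → _∶ₛ_ S N (datS δ) × code N ≡ apps h (codes Ns)) →
    Red (sortsTy S τs (dataT δ)) t
  Red-neutral [] h e n k with k [] []
  ... | N , d , q = N , d , dat (subst (λ z → Neut arity z []) (sym q) n) ,
    ≃-trans e (≃-reflexive (sym q))
  Red-neutral (τ ∷ τs) h e n k u ru with reify τ u ru
  ... | N , d , l , q =
    Red-neutral τs (app h (code N)) (≃-app e q) (app n l) λ Ns ds → k (N ∷ Ns) (d ∷ ds)

  Red-fn : ∀ f → Red (funTy S f) (var (fn f))
  Red-fn f = Red-neutral (argSorts f) (var (fn f)) ≃-refl (var (fn f)) λ Ns ds → fun f Ns , fun ds , refl

  -- The fundamental lemma of the logical relation: an applied abstraction is β-reduced and its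
  -- argument joins the environment.
  Red-eval : {M : Set} {tyM : M → Ty S} {Γ : List (Ty S)} {t : LTm S M} {A : Ty S} {e : Env M Name} →
    (∀ {i B} → _∋_∶_ S Γ i B → Red B (e (ix i))) →
    (∀ F → Red (tyM F) (e (fv F))) → (∀ f → Red (funTy S f) (e (con f))) →
    Typed S tyM Γ t A → Red A (eval e t)
  Red-eval p q r (var i) = p i
  Red-eval p q r (fv F) = q F
  Red-eval p q r (con f) = r f
  Red-eval {A = A ⇒ B} {e = e} p q r (lam {t = t} d) u ru =
    Red-≃ B (≃-trans (≃-β _ _) (≃-reflexive (eval-lam-inst t u)))
      (Red-eval (λ { here → ru ; (there i) → p i }) q r d)
  Red-eval p q r (app {u = u} d d′) = Red-eval p q r d _ (Red-eval p q r d′)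

  -- From a λ-solution to a nominal one

  module Solution (as : List (Atom S)) {M : Set} (tyM : M → Ty S) (θ : Var S → LTm S M)
    (θ-typed : ∀ X → Typed S tyM [] (θ X) (tyVar S as X)) where

    freshIndex : ℕ
    freshIndex = suc (max 0 (map proj₂ as))

    freshIndex-∉ : ∀ {ν} → ¬ (ν , freshIndex) ∈ as
    freshIndex-∉ i = <-irrefl refl (All.lookup (xs≤max 0 (map proj₂ as)) (∈-map⁺ proj₂ i))

    -- Metavariables of the λ-solution are instantiated by constant functions, so
    -- that what remains is first-order and can be read as a nominal term.
    default : Ty S → Λ Name
    default (atomT ν) = var (atm (ν , freshIndex))
    default (dataT δ) = var (gv (datS δ , 0))
    default (A ⇒ B) = lam (wk (default B))

    Red-default : ∀ A → Red A (default A)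
    Red-default (atomT ν) = freshIndex , ≃-refl
    Red-default (dataT δ) = susp [] (datS δ , 0) , susp [] , dat (var _) , ≃-refl
    Red-default (A ⇒ B) u ru =
      Red-≃ B (≃-trans (≃-β _ _) (≃-reflexive (wk-inst (default B)))) (Red-default B)

    ren-default : {f g : Name → V} → (∀ ν → f (atm (ν , freshIndex)) ≡ g (atm (ν , freshIndex))) →
      (∀ X → f (gv X) ≡ g (gv X)) → ∀ A → ren f (default A) ≡ ren g (default A)
    ren-default p q (atomT ν) = cong var (p ν)
    ren-default p q (dataT δ) = cong var (q _)
    ren-default p q (A ⇒ B) = cong lam
      (trans (map-wk (default B)) (trans (cong wk (ren-default p q B)) (sym (map-wk (default B)))))

    env₀ : Env M Name
    -- An arbitrary closed value: `θ X` has no free index, and closed terms are invariant under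
    -- renaming.
    env₀ (ix i) = lam (var nothing)
    env₀ (fv F) = default (tyM F)
    env₀ (con f) = var (fn f)

    Θ : Var S → Λ Name
    Θ X = eval env₀ (θ X)

    args : Perm S → List (Λ Name)
    args π = map (λ a → var (atm (act S π a))) as

    Red-args : ∀ X bs {t} → Red (tyVar S bs X) t →
      Red (⟦_⟧ S (varSort S X)) (apps t (map (λ a → var (atm a)) bs))
    Red-args X [] r = r
    Red-args X (b ∷ bs) r = Red-args X bs (r _ (_ , ≃-refl))

    Θ-denotes : ∀ X → Denotes (varSort S X) (apps (Θ X) (args []))
    Θ-denotes X = reify (varSort S X) _ (Red-args X as
      (Red-eval {tyM = tyM} (λ ()) (Red-default ∘ tyM) Red-fn (θ-typed X)))

    σ : NSubst S
    σ X = proj₁ (Θ-denotes X)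

    -- Codes of instantiated terms.

    embθ : Term S → Λ Name
    embθ = emb λ π X → apps (Θ X) (args π)

    embsθ : List (Term S) → List (Λ Name)
    embsθ = embs λ π X → apps (Θ X) (args π)

    -- Free atoms of `Θ X` come from the defaults. They carry the fresh index, hence lie outside
    -- `as`, where the permutation is the identity.
    actName-Θ : ∀ {Xs π} → PermWithin as Xs π → ∀ X → ren (actName π) (Θ X) ≡ Θ X
    actName-Θ {Xs} h X = trans (ren-eval (θ X)) (eval-cong (λ where
      (ix i) → refl
      (fv F) → trans
        (ren-default {g = id} (λ ν → cong atm (act-∉ as Xs h freshIndex-∉)) (λ _ → refl) (tyM F))
        (ren-id (λ _ → refl) (default (tyM F)))
      (con f) → refl) (θ X))

    -- Renaming by the permutation fixes the head `Θ X` and permutes its arguments, which is how the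
    -- translation reads a suspension.
    code-susp : ∀ {Xs π} → PermWithin as Xs π → ∀ X → code (_∙_ S π (σ X)) ≃ apps (Θ X) (args π)
    code-susp {Xs} {π} h X = ≃-trans (≃-reflexive (code-act π (σ X)))
      (≃-trans (≃-ren (actName π) (≃-sym (proj₂ (proj₂ (proj₂ (Θ-denotes X))))))
        (≃-reflexive (trans (ren-apps (actName π) (Θ X) (args []))
          (cong₂ apps (actName-Θ {Xs} h X) (sym (map-∘ as))))))

    mutual
      code-nsub : ∀ {Xs} t → Within as Xs t → code (nsub S σ t) ≃ embθ t
      code-nsub {Xs} (fun f ts) w = codes-nsub {Xs} ts w ≃-refl
      code-nsub (atom a) w = ≃-refl
      code-nsub {Xs} (abs a t) (_ , w) = ≃-lam (≃-ren (bind a) (code-nsub {Xs} t w))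
      code-nsub {Xs} (susp π X) (h , _) = code-susp {Xs} h X

      codes-nsub : ∀ {Xs} ts → Withins as Xs ts → ∀ {h h′} → h ≃ h′ →
        apps h (codes (nsubs S σ ts)) ≃ apps h′ (embsθ ts)
      codes-nsub [] w e = e
      codes-nsub {Xs} (t ∷ ts) (w , ws) e = codes-nsub {Xs} ts ws (≃-app e (code-nsub {Xs} t w))

    mutual
      Long-nsub : ∀ {t τ} → _∶ₛ_ S t τ → Long arity τ (code (nsub S σ t))
      Long-nsub (fun {f} ds) = dat (Neut-nsubs (var (fn f)) ds)
      Long-nsub (atom a) = atm (var (atm a))
      Long-nsub (abs {a} d) = abs (Long-ren (arity-bind a) (Long-nsub d))
      Long-nsub (susp {π} {X} _) = subst (Long arity _) (sym (code-act π (σ X)))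
        (Long-ren (arity-actName π) (proj₁ (proj₂ (proj₂ (Θ-denotes X)))))

      Neut-nsubs : ∀ {ts τs h} → Neut arity h τs → Pointwise (_∶ₛ_ S) ts τs →
        Neut arity (apps h (codes (nsubs S σ ts))) []
      Neut-nsubs n [] = n
      Neut-nsubs n (d ∷ ds) = Neut-nsubs (app n (Long-nsub d)) ds

    -- Evaluating the translation.

    record Interprets (ctx : List (Atom S)) (e : Env M V) (g : Name → V) : Set where
      field
        interp-ix  : ∀ b {i} → index S b ctx ≡ just i → e (ix i) ≡ var (g (atm b))
        interp-fv  : ∀ F → e (fv F) ≡ ren g (default (tyM F))
        interp-con : ∀ f → e (con f) ≡ var (g (fn f))
    open Interprets

    -- Shadowing agrees on both sides: `index` finds the innermost binder, and `bind a` captures `a`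
    -- before `g` sees it. Since `a` is in `as`, no default atom is captured.
    Interprets-abs : ∀ {ctx} {e : Env M V} {g : Name → V} {a} → a ∈ as → Interprets ctx e g →
      Interprets (a ∷ ctx) (liftEnv e) (Maybe.map g ∘ bind a)
    Interprets-abs {ctx = ctx} {g = g} {a} a∈ I .interp-ix b q with _≟_ S b a
    Interprets-abs {g = g} a∈ I .interp-ix b refl | yes refl =
      cong var (sym (cong (Maybe.map g) (bind-same b)))
    ... | no b≢a with index S b ctx in eq
    Interprets-abs {g = g} a∈ I .interp-ix b refl | no b≢a | just i =
      trans (cong wk (interp-ix I b eq)) (cong var (sym (cong (Maybe.map g) (bind-other (b≢a ∘ sym)))))
    Interprets-abs {g = g} a∈ I .interp-fv F = trans (cong wk (interp-fv I F)) (trans (ren-ren (default (tyM F)))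
      (ren-default (λ ν → cong (Maybe.map g) (sym (bind-other λ { refl → freshIndex-∉ a∈ }))) (λ _ → refl) (tyM F)))
    Interprets-abs a∈ I .interp-con f = cong wk (interp-con I f)

    eval-θ : ∀ {ctx} {e : Env M V} {g : Name → V} → Interprets ctx e g → ∀ X → eval e (θ X) ≡ ren g (Θ X)
    eval-θ I X = trans (eval-cong-Typed (λ ()) (interp-fv I) (interp-con I) (θ-typed X)) (sym (ren-eval (θ X)))

    eval-suspArgs : ∀ {ctx} {e : Env M V} {g : Name → V} → Interprets ctx e g → ∀ π bs h {s} →
      suspArgs S ctx π bs h ≡ just s →
      eval e (lsub S θ s) ≡ apps (eval e (lsub S θ h)) (map (λ b → var (g (atm (act S π b)))) bs)
    eval-suspArgs I π [] h refl = refl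
    eval-suspArgs {ctx = ctx} {e} {g} I π (b ∷ bs) h q with index S (act S π b) ctx in eq
    ... | just i = trans (eval-suspArgs I π bs (h · var i) q)
      (cong (λ z → apps (app (eval e (lsub S θ h)) z) (map (λ b → var (g (atm (act S π b)))) bs)) (interp-ix I (act S π b) eq))

    mutual
      -- Translation and embedding build the same spines and abstractions, hence equality; β is
      -- needed only for the outer λ-prefix, in `apps-lams`.
      eval-tr : ∀ {Xs ctx} {e : Env M V} {g : Name → V} → Interprets ctx e g → ∀ t → Within as Xs t → ∀ {s} →
        tr S as ctx t ≡ just s → eval e (lsub S θ s) ≡ ren g (embθ t)
      eval-tr {Xs = Xs} {g = g} I (fun f ts) w q = trans (eval-trs {Xs = Xs} I ts w (con f) q)
        (trans (cong (λ z → apps z (map (ren g) (embsθ ts))) (interp-con I f)) (sym (ren-apps g (var (fn f)) (embsθ ts))))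
      eval-tr {ctx = ctx} I (atom a) w q with index S a ctx in eq
      eval-tr I (atom a) w refl | just i = interp-ix I a eq
      eval-tr {Xs = Xs} {ctx} I (abs a t) (a∈ , w) q with tr S as (a ∷ ctx) t in eq
      eval-tr {Xs = Xs} I (abs a t) (a∈ , w) refl | just s =
        cong lam (trans (eval-tr {Xs = Xs} (Interprets-abs a∈ I) t w eq) (sym (ren-ren (embθ t))))
      eval-tr {g = g} I (susp π X) w q = trans (eval-suspArgs I π as (fv X) q)
        (trans (cong₂ apps (eval-θ I X) (map-∘ as)) (sym (ren-apps g (Θ X) (args π))))

      eval-trs : ∀ {Xs ctx} {e : Env M V} {g : Name → V} → Interprets ctx e g → ∀ ts → Withins as Xs ts → ∀ h {s} →
        trs S as ctx ts h ≡ just s →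
        eval e (lsub S θ s) ≡ apps (eval e (lsub S θ h)) (map (ren g) (embsθ ts))
      eval-trs I [] w h refl = refl
      eval-trs {Xs = Xs} {ctx} {e} {g} I (t ∷ ts) (w , ws) h q with tr S as ctx t in eq
      ... | just u = trans (eval-trs {Xs = Xs} I ts ws (h · u) q)
        (cong (λ z → apps (app (eval e (lsub S θ h)) z) (map (ren g) (embsθ ts))) (eval-tr {Xs = Xs} I t w eq))

    -- The last atom ends up at index zero, in accordance with `reverse as` in `trTop`.
    bindEnv : Env M Name → List (Atom S) → Env M Name
    bindEnv e [] = e
    bindEnv e (b ∷ bs) = bindEnv (consEnv (var (atm b)) e) bs

    Interprets-cons : ∀ {ctx} {e : Env M Name} b → Interprets ctx e id → Interprets (b ∷ ctx) (consEnv (var (atm b)) e) id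
    Interprets-cons b I .interp-ix a q with _≟_ S a b
    Interprets-cons b I .interp-ix a refl | yes refl = refl
    Interprets-cons {ctx} b I .interp-ix a q | no _ with index S a ctx in eq
    Interprets-cons {ctx} b I .interp-ix a refl | no _ | just i = interp-ix I a eq
    Interprets-cons b I .interp-fv = interp-fv I
    Interprets-cons b I .interp-con = interp-con I

    Interprets-bindEnv : ∀ bs {ctx} {e : Env M Name} → Interprets ctx e id →
      Interprets (foldl (λ c b → b ∷ c) ctx bs) (bindEnv e bs) id
    Interprets-bindEnv [] I = I
    Interprets-bindEnv (b ∷ bs) I = Interprets-bindEnv bs (Interprets-cons b I)

    Interprets-top : Interprets (reverse as) (bindEnv env₀ as) id
    Interprets-top = Interprets-bindEnv as {e = env₀} record
      { interp-ix = λ _ ()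
      ; interp-fv = λ F → sym (ren-id (λ _ → refl) (default (tyM F)))
      ; interp-con = λ _ → refl }

    apps-lams : ∀ bs (e : Env M Name) s →
      apps (eval e (lsub S θ (lams S bs s))) (map (λ a → var (atm a)) bs) ≃ eval (bindEnv e bs) (lsub S θ s)
    apps-lams [] e s = ≃-refl
    apps-lams (b ∷ bs) e s = ≃-trans
      (≃-apps (≃-trans (≃-β _ _) (≃-reflexive (eval-lam-inst (lsub S θ (lams S bs s)) _)))
        (map (λ a → var (atm a)) bs))
      (apps-lams bs _ s)

    eval-trTop : ∀ t {s} → atomsT S t ⊆ as → trTop S as t ≡ just s →
      apps (eval env₀ (lsub S θ s)) (args []) ≃ code (nsub S σ t)
    eval-trTop t h q with tr S as (reverse as) t in eq
    eval-trTop t h refl | just s = ≃-trans (apps-lams as env₀ s)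
      (≃-trans (≃-reflexive (trans (eval-tr {Xs = varsT t} Interprets-top t w eq) (ren-id (λ _ → refl) (embθ t))))
        (≃-sym (code-nsub {varsT t} t w)))
      where
      w : Within as (varsT t) t
      w = Within-⊆ as (varsT t) t h id

    code-unified : ∀ t u {τ s s′} → _∶ₛ_ S t τ → _∶ₛ_ S u τ → atomsT S t ⊆ as → atomsT S u ⊆ as →
      trTop S as t ≡ just s → trTop S as u ≡ just s′ → _≃βη_ S (lsub S θ s) (lsub S θ s′) →
      code (nsub S σ t) ≡ code (nsub S σ u)
    code-unified t u dt du ht hu qt qu e = Long-unique (Long-nsub dt) (Long-nsub du)
      (≃-trans (≃-sym (eval-trTop t ht qt))
        (≃-trans (≃-apps (eval-sound e env₀) (args [])) (eval-trTop u hu qu)))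

    -- Assembling the nominal solution.

    Unifies : Term S × Term S → Set
    Unifies (t , u) = ∃₂ λ s s′ → (trTop S as t ≡ just s) × (trTop S as u ≡ just s′) ×
      _≃βη_ S (lsub S θ s) (lsub S θ s′)

    sides : Problem S → List (Term S)
    sides [] = []
    sides ((t , u) ∷ P) = nsub S σ t ∷ nsub S σ u ∷ sides P

    unified : ∀ L Xs P → Withins L Xs (sides P) →
      All (λ e → code (nsub S σ (proj₁ e)) ≡ code (nsub S σ (proj₂ e))) P →
      All (λ e → _⊢_≈_ S (cartesianProduct L Xs) (nsub S σ (proj₁ e)) (nsub S σ (proj₂ e))) P
    unified L Xs [] w [] = []
    unified L Xs ((t , u) ∷ P) (wt , wu , ws) (e ∷ es) = code-≡⇒≈ L Xs (nsub S σ t) (nsub S σ u) wt wu e ∷ unified L Xs P ws es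

    codes-unified : ∀ P → WellSorted S P → atomsP S P ⊆ as →
      All Unifies P →
      All (λ e → code (nsub S σ (proj₁ e)) ≡ code (nsub S σ (proj₂ e))) P
    codes-unified [] [] h [] = []
    codes-unified ((t , u) ∷ P) ((τ , dt , du) ∷ ds) h ((s , s′ , qt , qu , e) ∷ es) =
      code-unified t u dt du (h ∘ ∈-++⁺ˡ) (h ∘ ∈-++⁺ʳ (atomsT S t) ∘ ∈-++⁺ˡ) qt qu e ∷
      codes-unified P ds (h ∘ ∈-++⁺ʳ (atomsT S t) ∘ ∈-++⁺ʳ (atomsT S u)) es

    solved : ∀ P → WellSorted S P → atomsP S P ⊆ as →
      All Unifies P →
      NSolvable S P
    solved P ds h es = cartesianProduct L Xs , σ , (λ X → proj₁ (proj₂ (Θ-denotes X))) ,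
      unified L Xs P (Withins-⊆ L Xs (sides P) id id) (codes-unified P ds h es)
      where
      -- Collected from the instantiated sides, because `σ` can introduce atoms and variables absent
      -- from `P`.
      L = atomsTs S (sides P)
      Xs = varsTs (sides P)

theorem7p7 : (S : Signature) (P : Problem S) → WellSorted S P →
    (as : List (Atom S)) → AtomEnumeration S P as →
    LSolvable S as P → NSolvable S P
theorem7p7 S P ws as (_ , enum) (M , tyM , θ , θ-typed , es) =
  Nominal.Solution.solved S as tyM θ θ-typed P ws (λ {a} → Equivalence.from (enum a)) es
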